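{- Let $\mathbb K=(A,\prec,\mathcal D)$ be a defined proto sdp-algebra with $A$ a bounded lattice (a co-Heyting algebra for items 3 and 4), and let $\overline{\mathcal D}=(A\times A)\setminus\mathcal D$. Let $\lhd a=\bigwedge\{b\in A\mid a\,\overline{\mathcal D}\,b\}$ in $A^\delta$. For $1\le i\le4$ let $\prec_i$, $\overline{\mathcal D}_i$ be the closures of $\prec$, $\overline{\mathcal D}$ defined in the context, and let $\Diamond_ia=\bigwedge\{b\in A\mid a\prec_ib\}$ and $\lhd_ia=\bigwedge\{b\in A\mid a\,\overline{\mathcal D}_i\,b\}$ in $A^\delta$. Among maps $f:A\to A^\delta$ with $f(a)\in K(A^\delta)$ for all $a\in A$, ordered pointwise: 1. $\lhd_1$ is the largest antitone map dominated by $\lhd$. 2. $\lhd_2$ is the largest regular map dominated by $\lhd$. 3. $\lhd_3$ is the largest antitone map $f$ dominated by $\lhd$ which satisfies $f(a)\le\Diamond_3(f(a)\setminus a)$ for all $a\in A$. 4. $\lhd_4$ is the largest regular map $f$ dominated by $\lhd$ which satisfies $f(a)\le\Diamond_4(f(a)\setminus a)$ for all $a\in A$. (In each item it is part of the claim that $\lhd_i$ itself is a map of the stated kind.)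
   Context: Canonical extension. For a poset $A$, $A^\delta$ is a complete lattice containing $A$ as a subposet. $k\in A^\delta$ is closed ($k\in K(A^\delta)$) if $k=\bigwedge F$ for some nonempty down-directed $F\subseteq A$; $o$ is open if $o=\bigvee I$ for some nonempty up-directed $I\subseteq A$. Denseness: every element of $A^\delta$ is a join of closed elements and a meet of open elements. Compactness: if $F\subseteq A$ is nonempty down-directed, $I\subseteq A$ nonempty up-directed and $\bigwedge F\le\bigvee I$, then $a\le b$ for some $a\in F$, $b\in I$. $A^\delta$ exists and is unique up to isomorphism fixing $A$. A co-Heyting algebra is a (bounded) distributive lattice with a binary operation $\setminus$ such that $a\setminus b\le c$ iff $a\le c\vee b$. In that case, for $u,v\in A^\delta$, $u\setminus v$ denotes the least $w\in A^\delta$ with $u\le w\vee v$. A proto sdp-algebra is $(A,\prec,\mathcal D)$ with $\prec,\mathcal D\subseteq A\times A$. It is defined if for $\prec$: $\forall a\exists b(b\prec a)$; $\forall a\exists b(a\prec b)$; $a\prec x_1\ \&\ a\prec x_2\Rightarrow\exists x(a\prec x\ \&\ x\le x_1\ \&\ x\le x_2)$; $a_1\prec x\ \&\ a_2\prec x\Rightarrow\exists a(a\prec x\ \&\ a_1\le a\ \&\ a_2\le a)$; and for $\overline{\mathcal D}$: $\forall a\exists b(b\,\overline{\mathcal D}\,a)$; $\forall a\exists b(a\,\overline{\mathcal D}\,b)$; $a\,\overline{\mathcal D}\,x_1\ \&\ a\,\overline{\mathcal D}\,x_2\Rightarrow\exists x(x\le x_1\ \&\ x\le x_2\ \&\ a\,\overline{\mathcal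 D}\,x)$; $a_1\,\overline{\mathcal D}\,x\ \&\ a_2\,\overline{\mathcal D}\,x\Rightarrow\exists a(a\le a_1\ \&\ a\le a_2\ \&\ a\,\overline{\mathcal D}\,x)$. $\prec_i$ is the smallest extension of $\prec$ satisfying: $\top\prec\top$, $a\le b\prec x\Rightarrow a\prec x$, $b\prec x\le y\Rightarrow b\prec y$, $a\prec x\ \&\ a\prec y\Rightarrow a\prec x\wedge y$; together with, for $i\in\{2,4\}$, $a\prec x\ \&\ b\prec x\Rightarrow a\vee b\prec x$; and, for $i\in\{3,4\}$, $a\prec b\ \&\ a\wedge b\prec c\Rightarrow a\prec c$. $\overline{\mathcal D}_i$ is the smallest extension $N$ of $\overline{\mathcal D}$ satisfying: $\bot\,N\,\top$; $a\le b\ \&\ a\,N\,c\Rightarrow b\,N\,c$; $a\,N\,c\ \&\ c\le b\Rightarrow a\,N\,b$; $a\,N\,b\ \&\ a\,N\,c\Rightarrow a\,N\,(b\wedge c)$; together with, for $i\in\{2,4\}$, $a\,N\,c\ \&\ b\,N\,c\Rightarrow(a\wedge b)\,N\,c$; and, for $i\in\{3,4\}$, $a\,N\,b\ \&\ (b\setminus a)\prec_ic\Rightarrow a\,N\,c$. $f$ is dominated by $\lhd$ if $f(a)\le\lhd a$ for all $a\in A$; antitone if $a\le b$ implies $f(b)\le f(a)$; regular if $f(a\wedge b)=f(a)\vee f(b)$ for all $a,b\in A$. $\Diamond_i$ is evaluated at a closed element $k$ by $\Diamond_ik:=\bigwedge\{\Diamond_ic\mid c\in A,k\le c\}$ (the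 element $f(a)\setminus a$ is closed). -}

module Defs where

open import Data.Bool.Base using (Bool; if_then_else_)
open import Data.Nat.Base using (ℕ)
open import Data.Product.Base using (Σ; ∃; ∃-syntax; _×_; _,_; proj₁)
open import Data.Sum.Base using (_⊎_)
open import Function.Bundles using (_⇔_)
open import Function.Definitions using (Congruent)
open import Level using (Level; Lift; lower; _⊔_) renaming (suc to lsuc)
open import Relation.Binary.Bundles using (Poset)
open import Relation.Binary.Core using (Rel)
open import Relation.Binary.Definitions using (Antitonic₁; _Respects₂_)
open import Relation.Binary.Lattice.Bundles using (BoundedLattice)
open import Relation.Binary.Lattice.Structures using (IsDistributiveLattice)
open import Relation.Binary.Morphism.Structures using (IsOrderMonomorphism)
open import Relation.Binary.PropositionalEquality.Core using (_≡_)
open import Relation.Nullary.Negation.Core using (¬_)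
open import Relation.Unary using (Pred; Satisfiable)

private
  variable
    ℓ : Level

-- Joins and meets are those of families indexed by types in Set i. When
-- c ≤ i these include all joins and meets of subsets of the carrier. The
-- level i is kept independent of c so that canonical extensions can also be
-- constructed predicatively (as cuts of filters and ideals), where the
-- carrier lives in a larger universe than the index types.

record CompleteLattice (c r i : Level) : Set (lsuc (c ⊔ r ⊔ i)) where
  field
    poset : Poset c r r

  open Poset poset public

  field
    ⋁       : {I : Set i} → (I → Carrier) → Carrier
    ⋁-upper : ∀ {I : Set i} (g : I → Carrier) j → g j ≤ ⋁ g
    ⋁-least : ∀ {I : Set i} (g : I → Carrier) x → (∀ j → g j ≤ x) → ⋁ g ≤ x

    ⋀          : {I : Set i} → (I → Carrier) → Carrier
    ⋀-lower    : ∀ {I : Set i} (g : I → Carrier) j → ⋀ g ≤ g j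
    ⋀-greatest : ∀ {I : Set i} (g : I → Carrier) x → (∀ j → x ≤ g j) → x ≤ ⋀ g

  infixr 6 _∨_
  _∨_ : Carrier → Carrier → Carrier
  u ∨ v = ⋁ {Lift i Bool} (λ b → if lower b then u else v)

  -- w is u ∖ v, the least element with u ≤ w ∨ v.
  IsDifference : (u v w : Carrier) → Set (c ⊔ r)
  IsDifference u v w = u ≤ w ∨ v × (∀ x → u ≤ x ∨ v → w ≤ x)

module _ {c r p : Level} (P : Poset c r p) where

  open Poset P

  DownDirected : ∀ {s} → Pred Carrier s → Set _
  DownDirected F = ∀ {a b} → F a → F b → ∃[ x ] F x × x ≤ a × x ≤ b

  UpDirected : ∀ {s} → Pred Carrier s → Set _
  UpDirected I = ∀ {a b} → I a → I b → ∃[ x ] I x × a ≤ x × b ≤ x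

module Extension {ℓ c m : Level} (P : Poset ℓ ℓ ℓ)
                 (C : CompleteLattice c (ℓ ⊔ m) (ℓ ⊔ m))
                 (ι : Poset.Carrier P → CompleteLattice.Carrier C) where

  private
    module P = Poset P
    module C = CompleteLattice C

  ⋀⟦_⟧ : Pred P.Carrier ℓ → C.Carrier
  ⋀⟦ F ⟧ = C.⋀ {Lift m (∃ F)} (λ j → ι (proj₁ (lower j)))

  ⋁⟦_⟧ : Pred P.Carrier ℓ → C.Carrier
  ⋁⟦ I ⟧ = C.⋁ {Lift m (∃ I)} (λ j → ι (proj₁ (lower j)))

  IsClosed : C.Carrier → Set (lsuc ℓ ⊔ m)
  IsClosed k = Σ (Pred P.Carrier ℓ) λ F →
    Satisfiable F × DownDirected P F × k C.≈ ⋀⟦ F ⟧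

  IsOpen : C.Carrier → Set (lsuc ℓ ⊔ m)
  IsOpen o = Σ (Pred P.Carrier ℓ) λ I →
    Satisfiable I × UpDirected P I × o C.≈ ⋁⟦ I ⟧

record CanonicalExtension {ℓ} (P : Poset ℓ ℓ ℓ) (c m : Level)
                          : Set (lsuc (ℓ ⊔ c ⊔ m)) where
  field
    completeLattice : CompleteLattice c (ℓ ⊔ m) (ℓ ⊔ m)

  private
    module P = Poset P
  open CompleteLattice completeLattice public

  field
    ι           : P.Carrier → Carrier
    isEmbedding : IsOrderMonomorphism P._≈_ _≈_ P._≤_ _≤_ ι

  open Extension {m = m} P completeLattice ι public

  field
    denseness-closed : ∀ u → Σ (Set (ℓ ⊔ m)) λ J → Σ (J → Carrier) λ g →
                       (∀ j → IsClosed (g j)) × u ≈ ⋁ g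
    denseness-open   : ∀ u → Σ (Set (ℓ ⊔ m)) λ J → Σ (J → Carrier) λ g →
                       (∀ j → IsOpen (g j)) × u ≈ ⋀ g
    compactness      : ∀ (F I : Pred P.Carrier ℓ) →
                       Satisfiable F → DownDirected P F →
                       Satisfiable I → UpDirected P I →
                       ⋀⟦ F ⟧ ≤ ⋁⟦ I ⟧ →
                       ∃[ a ] ∃[ b ] F a × I b × a P.≤ b

record CoHeyting (L : BoundedLattice ℓ ℓ ℓ) : Set ℓ where
  open BoundedLattice L
  infixl 6 _∖_
  field
    isDistributiveLattice : IsDistributiveLattice _≈_ _≤_ _∨_ _∧_
    _∖_                   : Carrier → Carrier → Carrier
    ∖-adjoint             : ∀ a b c → (a ∖ b ≤ c) ⇔ (a ≤ c ∨ b)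

record ProtoSDP (L : BoundedLattice ℓ ℓ ℓ) : Set (lsuc ℓ) where
  open BoundedLattice L
  infix 4 _≺_ _D̄_
  field
    _≺_    : Rel Carrier ℓ
    _D_    : Rel Carrier ℓ
    ≺-resp : _≺_ Respects₂ _≈_
    D-resp : _D_ Respects₂ _≈_

  _D̄_ : Rel Carrier ℓ
  a D̄ b = ¬ (a D b)

record Defined {L : BoundedLattice ℓ ℓ ℓ} (K : ProtoSDP L) : Set ℓ where
  open BoundedLattice L
  open ProtoSDP K
  field
    ≺-below : ∀ a → ∃[ b ] b ≺ a
    ≺-above : ∀ a → ∃[ b ] a ≺ b
    ≺-down  : ∀ {a x₁ x₂} → a ≺ x₁ → a ≺ x₂ → ∃[ x ] a ≺ x × x ≤ x₁ × x ≤ x₂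
    ≺-up    : ∀ {a₁ a₂ x} → a₁ ≺ x → a₂ ≺ x → ∃[ a ] a ≺ x × a₁ ≤ a × a₂ ≤ a

    D̄-left  : ∀ a → ∃[ b ] b D̄ a
    D̄-right : ∀ a → ∃[ b ] a D̄ b
    D̄-downʳ : ∀ {a x₁ x₂} → a D̄ x₁ → a D̄ x₂ → ∃[ x ] x ≤ x₁ × x ≤ x₂ × a D̄ x
    D̄-downˡ : ∀ {a₁ a₂ x} → a₁ D̄ x → a₂ D̄ x → ∃[ a ] a ≤ a₁ × a ≤ a₂ × a D̄ x

-- Of the indices, _≺[_]_ is meant for 1, 2, 3, 4, _D̄[_]_ for 1, 2 and
-- _D̄∖[_]_ for 3, 4.

module Closures {L : BoundedLattice ℓ ℓ ℓ} (K : ProtoSDP L) where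

  open BoundedLattice L
  open ProtoSDP K

  infix 4 _≺[_]_

  data _≺[_]_ : Carrier → ℕ → Carrier → Set ℓ where
    base : ∀ {i a x} → a ≺ x → a ≺[ i ] x
    top  : ∀ {i} → ⊤ ≺[ i ] ⊤
    ≤-≺  : ∀ {i a b x} → a ≤ b → b ≺[ i ] x → a ≺[ i ] x
    ≺-≤  : ∀ {i b x y} → b ≺[ i ] x → x ≤ y → b ≺[ i ] y
    meet : ∀ {i a x y} → a ≺[ i ] x → a ≺[ i ] y → a ≺[ i ] x ∧ y
    join : ∀ {i a b x} → i ≡ 2 ⊎ i ≡ 4 →
           a ≺[ i ] x → b ≺[ i ] x → a ∨ b ≺[ i ] x
    cut  : ∀ {i a b c} → i ≡ 3 ⊎ i ≡ 4 →
           a ≺[ i ] b → a ∧ b ≺[ i ] c → a ≺[ i ] c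

  infix 4 _D̄[_]_

  data _D̄[_]_ : Carrier → ℕ → Carrier → Set ℓ where
    base : ∀ {i a b} → a D̄ b → a D̄[ i ] b
    ⊥-⊤  : ∀ {i} → ⊥ D̄[ i ] ⊤
    ≤-D̄  : ∀ {i a b c} → a ≤ b → a D̄[ i ] c → b D̄[ i ] c
    D̄-≤  : ∀ {i a b c} → a D̄[ i ] c → c ≤ b → a D̄[ i ] b
    meet : ∀ {i a b c} → a D̄[ i ] b → a D̄[ i ] c → a D̄[ i ] b ∧ c
    glue : ∀ {i a b c} → i ≡ 2 → a D̄[ i ] c → b D̄[ i ] c → a ∧ b D̄[ i ] c

  module WithDifference (H : CoHeyting L) where

    open CoHeyting H using (_∖_)

    infix 4 _D̄∖[_]_

    data _D̄∖[_]_ : Carrier → ℕ → Carrier → Set ℓ where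
      base : ∀ {i a b} → a D̄ b → a D̄∖[ i ] b
      ⊥-⊤  : ∀ {i} → ⊥ D̄∖[ i ] ⊤
      ≤-D̄  : ∀ {i a b c} → a ≤ b → a D̄∖[ i ] c → b D̄∖[ i ] c
      D̄-≤  : ∀ {i a b c} → a D̄∖[ i ] c → c ≤ b → a D̄∖[ i ] b
      meet : ∀ {i a b c} → a D̄∖[ i ] b → a D̄∖[ i ] c → a D̄∖[ i ] b ∧ c
      glue : ∀ {i a b c} → i ≡ 4 →
             a D̄∖[ i ] c → b D̄∖[ i ] c → a ∧ b D̄∖[ i ] c
      cut  : ∀ {i a b c} → i ≡ 3 ⊎ i ≡ 4 →
             a D̄∖[ i ] b → b ∖ a ≺[ i ] c → a D̄∖[ i ] c

module Slanted {L : BoundedLattice ℓ ℓ ℓ} (K : ProtoSDP L) {c m : Level}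
               (E : CanonicalExtension (BoundedLattice.poset L) c m) where

  private
    module A = BoundedLattice L
  open ProtoSDP K using (_D̄_)
  open Closures K
  open CanonicalExtension E

  Map : Set (ℓ ⊔ c)
  Map = A.Carrier → Carrier

  ◁ : Map
  ◁ a = ⋀⟦ (λ b → a D̄ b) ⟧

  ◁[_] : ℕ → Map
  ◁[ i ] a = ⋀⟦ (λ b → a D̄[ i ] b) ⟧

  ◁∖[_]_ : ℕ → CoHeyting L → Map
  (◁∖[ i ] H) a = ⋀⟦ (λ b → a D̄∖[ i ] b) ⟧
    where open WithDifference H

  ◇[_] : ℕ → Map
  ◇[ i ] a = ⋀⟦ (λ b → a ≺[ i ] b) ⟧

  -- The extension of ◇[ i ] to closed elements.
  ◇ᴷ[_] : ℕ → Carrier → Carrier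
  ◇ᴷ[ i ] k = ⋀ {∃[ a ] k ≤ ι a} (λ j → ◇[ i ] (proj₁ j))

  -- Congruence makes f a function on A, whose equality is a setoid equality.
  record IsClosedMap (f : Map) : Set (lsuc ℓ ⊔ m) where
    field
      cong   : Congruent A._≈_ _≈_ f
      closed : ∀ a → IsClosed (f a)

  Dominated : Map → Set (ℓ ⊔ m)
  Dominated f = ∀ a → f a ≤ ◁ a

  Antitone : Map → Set (ℓ ⊔ m)
  Antitone f = Antitonic₁ A._≤_ _≤_ f

  Regular : Map → Set (ℓ ⊔ m)
  Regular f = ∀ a b → f (a A.∧ b) ≈ f a ∨ f b

  -- f(a) ≤ ◇ᵢ (f(a) ∖ a) for all a. The element f(a) ∖ a, unique up to ≈, is
  -- introduced by its defining property; over a co-Heyting algebra it exists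
  -- whenever f(a) is closed.
  SelfBounded : ℕ → Map → Set (ℓ ⊔ c ⊔ m)
  SelfBounded i f =
    ∀ a → ∃[ w ] IsDifference (f a) (ι a) w × f a ≤ ◇ᴷ[ i ] w

  IsLargest : ∀ {s} → Pred Map s → Map → Set _
  IsLargest Φ g = Φ g × (∀ f → Φ f → ∀ a → f a ≤ g a)

{-# OPTIONS --safe #-}

-- Every set {b | a N b} defining ◁ᵢ a is a filter of A, and compactness says
-- that ⋀ F ≤ ι c holds exactly when c ∈ F. So each closure rule for N becomes
-- a property of the map a ↦ ⋀ {b | a N b}, with denseness reducing
-- inequalities u ≤ v to the case where v is open. The difference (⋀ F) ∖ a is
-- the meet of the filter {x | x ∨ a ∈ F}, which translates the cut rule into
-- f(a) ≤ ◇ᵢ (f(a) ∖ a). Maximality is induction on derivations of a N b,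
-- showing f(a) ≤ ι b.

module Submission where

open import Data.Bool.Base using (true; false)
open import Data.Nat.Base using (ℕ)
open import Data.Product.Base using (∃-syntax; _×_; _,_; proj₂)
open import Data.Sum.Base using (inj₁; inj₂)
open import Function.Bundles using (module Equivalence)
open import Level using (Level; lift; lower)
open import Relation.Binary.Core using (Rel)
open import Relation.Binary.Lattice.Bundles using (BoundedLattice)
import Relation.Binary.Lattice.Properties.JoinSemilattice as JoinProperties
open import Relation.Binary.Morphism.Structures using (module IsOrderMonomorphism)
open import Relation.Binary.PropositionalEquality.Core using (_≡_; refl)
open import Relation.Unary using (Pred; Satisfiable; _⊆_)
open import Defs

-- Filters of a bounded lattice and their differences by an element.

module Filters {ℓ : Level} (L : BoundedLattice ℓ ℓ ℓ) where

  open BoundedLattice L renaming (refl to ≤-refl)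
  open JoinProperties joinSemilattice using (∨-monotonic)

  record IsFilter (F : Pred Carrier ℓ) : Set ℓ where
    field
      ⊤∈       : F ⊤
      upper    : ∀ {a b} → a ≤ b → F a → F b
      ∧-closed : ∀ {a b} → F a → F b → F (a ∧ b)

    satisfiable : Satisfiable F
    satisfiable = ⊤ , ⊤∈

    downDirected : DownDirected poset F
    downDirected {a} {b} Fa Fb =
      a ∧ b , ∧-closed Fa Fb , x∧y≤x a b , x∧y≤y a b

  open IsFilter

  ↑-isFilter : ∀ a → IsFilter (a ≤_)
  ↑-isFilter a = record
    { ⊤∈       = maximum a
    ; upper    = λ b≤c a≤b → trans a≤b b≤c
    ; ∧-closed = ∧-greatest
    }

  module _ (H : CoHeyting L) where

    open CoHeyting H

    x≤x∖y∨y : ∀ x y → x ≤ (x ∖ y) ∨ y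
    x≤x∖y∨y x y = Equivalence.to (∖-adjoint x y (x ∖ y)) ≤-refl

    x∨y∖y≤x : ∀ x y → (x ∨ y) ∖ y ≤ x
    x∨y∖y≤x x y =
      Equivalence.from (∖-adjoint (x ∨ y) y x) ≤-refl

    difference-isFilter : ∀ {F} a → IsFilter F → IsFilter (λ x → F (x ∨ a))
    difference-isFilter a isF = record
      { ⊤∈       = upper isF (x≤x∨y ⊤ a) (⊤∈ isF)
      ; upper    = λ x≤y → upper isF (∨-monotonic x≤y ≤-refl)
      ; ∧-closed = λ {x} {y} Fx Fy →
          -- The adjunction puts `b ∖ a` below both `x` and `y`, so `b ≤ (b ∖ a) ∨ a ≤ (x ∧ y) ∨ a`.
          let b = (x ∨ a) ∧ (y ∨ a)
              b∖a≤ : ∀ {z} → b ≤ z ∨ a → b ∖ a ≤ z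
              b∖a≤ {z} = Equivalence.from (∖-adjoint b a z)
          in upper isF
               (trans (x≤x∖y∨y b a)
                 (∨-monotonic
                   (∧-greatest (b∖a≤ (x∧y≤x (x ∨ a) (y ∨ a)))
                               (b∖a≤ (x∧y≤y (x ∨ a) (y ∨ a))))
                   ≤-refl))
               (∧-closed isF Fx Fy)
      }

-- Closed elements as meets of filters; joins and differences in the extension.

module CanonicalExtensionProperties
  {ℓ c m : Level} (L : BoundedLattice ℓ ℓ ℓ)
  (E : CanonicalExtension (BoundedLattice.poset L) c m) where

  private
    module A = BoundedLattice L
  open CanonicalExtension E
  open IsOrderMonomorphism isEmbedding using () renaming (mono to ι-mono)
  open Filters L
  open IsFilter

  x≤x∨y : ∀ x y → x ≤ x ∨ y
  x≤x∨y x y = ⋁-upper _ (lift true)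

  y≤x∨y : ∀ x y → y ≤ x ∨ y
  y≤x∨y x y = ⋁-upper _ (lift false)

  ∨-least : ∀ {x y z} → x ≤ z → y ≤ z → x ∨ y ≤ z
  ∨-least x≤z y≤z =
    ⋁-least _ _ λ { (lift true) → x≤z ; (lift false) → y≤z }

  ⋀⟦⟧-lower : ∀ {F a} → F a → ⋀⟦ F ⟧ ≤ ι a
  ⋀⟦⟧-lower Fa = ⋀-lower _ (lift (_ , Fa))

  ⋀⟦⟧-greatest : ∀ {F x} → (∀ {a} → F a → x ≤ ι a) → x ≤ ⋀⟦ F ⟧
  ⋀⟦⟧-greatest x≤ = ⋀-greatest _ _ λ j → x≤ (proj₂ (lower j))

  ⋀⟦⟧-antitone : ∀ {F G} → F ⊆ G → ⋀⟦ G ⟧ ≤ ⋀⟦ F ⟧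
  ⋀⟦⟧-antitone F⊆G = ⋀⟦⟧-greatest λ Fa → ⋀⟦⟧-lower (F⊆G Fa)

  ⋁⟦⟧-upper : ∀ {I a} → I a → ι a ≤ ⋁⟦ I ⟧
  ⋁⟦⟧-upper Ia = ⋁-upper _ (lift (_ , Ia))

  ⋁⟦⟧-least : ∀ {I x} → (∀ {a} → I a → ι a ≤ x) → ⋁⟦ I ⟧ ≤ x
  ⋁⟦⟧-least ≤x = ⋁-least _ _ λ j → ≤x (proj₂ (lower j))

  ⋀⟦↑⟧≤ι : ∀ a → ⋀⟦ (a A.≤_) ⟧ ≤ ι a
  ⋀⟦↑⟧≤ι a = ⋀⟦⟧-lower A.refl

  -- By denseness `v` is a meet of open elements, and each of these lies above `v`.
  ≤-by-opens : ∀ {u v} →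
               (∀ I → Satisfiable I → UpDirected A.poset I →
                v ≤ ⋁⟦ I ⟧ → u ≤ ⋁⟦ I ⟧) →
               u ≤ v
  ≤-by-opens {u} {v} below with denseness-open v
  ... | J , g , g-open , v≈⋀g =
    trans (⋀-greatest g u u≤gj) (reflexive (Eq.sym v≈⋀g))
    where
    u≤gj : ∀ j → u ≤ g j
    u≤gj j with g-open j
    ... | I , sat , dir , gj≈⋁I =
      trans (below I sat dir
              (trans (reflexive v≈⋀g)
                (trans (⋀-lower g j) (reflexive gj≈⋁I))))
            (reflexive (Eq.sym gj≈⋁I))

  filter-meets-ideal : ∀ {F I} → IsFilter F →
                       Satisfiable I → UpDirected A.poset I →
                       ⋀⟦ F ⟧ ≤ ⋁⟦ I ⟧ → ∃[ b ] I b × F b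
  filter-meets-ideal {F} {I} isF sat dir ⋀F≤⋁I
    with compactness F I (satisfiable isF)
           (λ {a} {b} → downDirected isF {a} {b}) sat dir ⋀F≤⋁I
  ... | a , b , Fa , Ib , a≤b = b , Ib , upper isF a≤b Fa

  -- The principal ideal of `a` is up-directed with join above `ι a`, so `F` meets it and hence
  -- contains `a`.
  ⋀⟦⟧≤ι⇒∈ : ∀ {F a} → IsFilter F → ⋀⟦ F ⟧ ≤ ι a → F a
  ⋀⟦⟧≤ι⇒∈ {F} {a} isF ⋀F≤ιa
    with filter-meets-ideal {I = A._≤ a} isF (a , A.refl)
           (λ x≤a y≤a → a , A.refl , x≤a , y≤a)
           (trans ⋀F≤ιa (⋁⟦⟧-upper A.refl))
  ... | b , b≤a , Fb = upper isF b≤a Fb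

  isFilter⇒isClosed : ∀ {F} → IsFilter F → IsClosed ⋀⟦ F ⟧
  isFilter⇒isClosed {F} isF =
    F , satisfiable isF , (λ {a} {b} → downDirected isF {a} {b}) , Eq.refl

  -- The up-closure of a down-directed set is a filter with the same meet, so `⋀⟦⟧≤ι⇒∈` becomes
  -- applicable to arbitrary closed elements.
  isClosed⇒filter : ∀ {k} → IsClosed k →
                    ∃[ F ] IsFilter F × k ≤ ⋀⟦ F ⟧ × ⋀⟦ F ⟧ ≤ k
  isClosed⇒filter (F , (a , Fa) , dir , k≈⋀F) =
    (λ x → ∃[ y ] F y × y A.≤ x)
    , record
      { ⊤∈       = a , Fa , A.maximum a
      ; upper    = λ { x≤z (y , Fy , y≤x) → y , Fy , A.trans y≤x x≤z }
      ; ∧-closed = λ { (y , Fy , y≤x) (y′ , Fy′ , y′≤x′) →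
          let z , Fz , z≤y , z≤y′ = dir Fy Fy′
          in z , Fz , A.∧-greatest (A.trans z≤y y≤x) (A.trans z≤y′ y′≤x′) }
      }
    , ⋀⟦⟧-greatest (λ { (y , Fy , y≤x) →
        trans (reflexive k≈⋀F) (trans (⋀⟦⟧-lower Fy) (ι-mono y≤x)) })
    , trans (⋀⟦⟧-antitone (λ Fy → _ , Fy , A.refl)) (reflexive (Eq.sym k≈⋀F))

  closed≤ι⊤ : ∀ {k} → IsClosed k → k ≤ ι A.⊤
  closed≤ι⊤ isClosed with isClosed⇒filter isClosed
  ... | F , isF , k≤ , _ = trans k≤ (⋀⟦⟧-lower (⊤∈ isF))

  -- Both `a` and `b` belong to a filter whose meet is `k`, hence so does `a ∧ b`. This settles the
  -- `meet` rule in the inductions on derivations.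
  closed≤ι∧ : ∀ {k a b} → IsClosed k → k ≤ ι a → k ≤ ι b → k ≤ ι (a A.∧ b)
  closed≤ι∧ isClosed k≤ιa k≤ιb with isClosed⇒filter isClosed
  ... | F , isF , k≤ , ≤k =
    trans k≤ (⋀⟦⟧-lower (∧-closed isF (⋀⟦⟧≤ι⇒∈ isF (trans ≤k k≤ιa))
                                      (⋀⟦⟧≤ι⇒∈ isF (trans ≤k k≤ιb))))

  -- Contains both regularity of ◁ᵢ and preservation of binary joins by ι.
  ⋀⟦⟧≤∨ : ∀ {F G H} → IsFilter F → IsFilter G →
          (∀ {a} → F a → G a → H a) → ⋀⟦ H ⟧ ≤ ⋀⟦ F ⟧ ∨ ⋀⟦ G ⟧
  ⋀⟦⟧≤∨ isF isG F∩G⊆H = ≤-by-opens λ I sat dir ∨≤⋁I →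
    let a , Ia , Fa = filter-meets-ideal isF sat dir (trans (x≤x∨y _ _) ∨≤⋁I)
        b , Ib , Gb = filter-meets-ideal isG sat dir (trans (y≤x∨y _ _) ∨≤⋁I)
        x , Ix , a≤x , b≤x = dir Ia Ib
    in trans (⋀⟦⟧-lower (F∩G⊆H (upper isF a≤x Fa) (upper isG b≤x Gb)))
             (⋁⟦⟧-upper Ix)

  -- `ι a` is the meet of the principal filter of `a`, and the principal filters of `a` and `b`
  -- intersect in that of `a ∨ b`.
  ι-∨ : ∀ a b → ι (a A.∨ b) ≤ ι a ∨ ι b
  ι-∨ a b =
    trans (⋀⟦⟧-greatest ι-mono)
      (trans (⋀⟦⟧≤∨ (↑-isFilter a) (↑-isFilter b) A.∨-least)
        (∨-least (trans (⋀⟦↑⟧≤ι a) (x≤x∨y _ _))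
                 (trans (⋀⟦↑⟧≤ι b) (y≤x∨y _ _))))

  difference : CoHeyting L → ∀ {F} a → IsFilter F →
               IsDifference ⋀⟦ F ⟧ (ι a) ⋀⟦ (λ x → F (x A.∨ a)) ⟧
  difference H {F} a isF = ⋀F≤w∨ιa , least
    where
    w : Carrier
    w = ⋀⟦ (λ x → F (x A.∨ a)) ⟧

    ⋀F≤w∨ιa : ⋀⟦ F ⟧ ≤ w ∨ ι a
    ⋀F≤w∨ιa =
      -- If `x ∨ a` is in `F` and `a ≤ x`, then `x ∨ a ≤ x`, so `x` is in `F`.
      trans (⋀⟦⟧≤∨ (difference-isFilter H a isF) (↑-isFilter a)
              (λ Fx∨a a≤x → upper isF (A.∨-least A.refl a≤x) Fx∨a))
            (∨-least (x≤x∨y _ _) (trans (⋀⟦↑⟧≤ι a) (y≤x∨y _ _)))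

    least : ∀ x → ⋀⟦ F ⟧ ≤ x ∨ ι a → w ≤ x
    least x ⋀F≤x∨ιa = ≤-by-opens λ { I (i , Ii) dir x≤⋁I →
      -- `J` is the ideal generated by all `j ∨ a` with `j` in `I`. Its join bounds `⋁⟦ I ⟧` and, as
      -- `I` is inhabited, also `ι a`; hence it bounds `⋀⟦ F ⟧`. Compactness then puts some `j ∨ a`
      -- into `F`, which means `w ≤ ι j`.
      let J : Pred A.Carrier ℓ
          J y = ∃[ j ] I j × y A.≤ j A.∨ a

          J-upDirected : UpDirected A.poset J
          J-upDirected = λ { (j , Ij , y≤) (j′ , Ij′ , y′≤) →
            let k , Ik , j≤k , j′≤k = dir Ij Ij′
            in k A.∨ a , (k , Ik , A.refl)
               , A.trans y≤ (∨-monotonic j≤k A.refl)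
               , A.trans y′≤ (∨-monotonic j′≤k A.refl) }

          y , (j , Ij , y≤j∨a) , Fy =
            filter-meets-ideal {I = J} isF (i , i , Ii , A.x≤x∨y i a)
              J-upDirected
              (trans ⋀F≤x∨ιa (∨-least
                (trans x≤⋁I
                  (⋁⟦⟧-least λ {b} Ib → ⋁⟦⟧-upper (b , Ib , A.x≤x∨y b a)))
                (⋁⟦⟧-upper (i , Ii , A.y≤x∨y i a))))
      in trans (⋀⟦⟧-lower (upper isF y≤j∨a Fy)) (⋁⟦⟧-upper Ij) }
      where open JoinProperties A.joinSemilattice using (∨-monotonic)

-- Maps given by families of filters.

module SlantedProperties
  {ℓ c m : Level} {L : BoundedLattice ℓ ℓ ℓ} (K : ProtoSDP L)
  (E : CanonicalExtension (BoundedLattice.poset L) c m) where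

  private
    module A = BoundedLattice L
  open ProtoSDP K using (_D̄_)
  open Closures K
  open CanonicalExtension E hiding (refl)
  open IsOrderMonomorphism isEmbedding using () renaming (mono to ι-mono)
  open Slanted K E
  open Filters L
  open CanonicalExtensionProperties L E
  open IsClosedMap

  -- For `y ≤ x` the elements `y ∧ x` and `y` agree up to the setoid equality, so congruence of `f`
  -- turns regularity into `f y ≈ f y ∨ f x`.
  regular⇒antitone : ∀ {f} → IsClosedMap f → Regular f → Antitone f
  regular⇒antitone closedMap regular {x} {y} y≤x =
    trans (y≤x∨y _ _)
      (trans (reflexive (Eq.sym (regular y x)))
        (reflexive (cong closedMap
          (A.antisym (A.x∧y≤x y x) (A.∧-greatest A.refl y≤x)))))

  -- The relation `N` is kept abstract so that `_D̄[_]_` and `_D̄∖[_]_` can share one treatment.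
  module FilterMap
    (N : Rel A.Carrier ℓ) (N-isFilter : ∀ a → IsFilter (N a))
    (N-≤ : ∀ {a b c} → a A.≤ b → N a c → N b c) where

    ⋀N : Map
    ⋀N a = ⋀⟦ N a ⟧

    antitone : Antitone ⋀N
    antitone y≤x = ⋀⟦⟧-antitone (N-≤ y≤x)

    isClosedMap : IsClosedMap ⋀N
    isClosedMap = record
      { cong   = λ x≈y → antisym (antitone (A.reflexive (A.Eq.sym x≈y)))
                                 (antitone (A.reflexive x≈y))
      ; closed = λ a → isFilter⇒isClosed (N-isFilter a)
      }

    dominated : (∀ {a b} → a D̄ b → N a b) → Dominated ⋀N
    dominated D̄⊆N a = ⋀⟦⟧-antitone D̄⊆N

    regular : (∀ {a b c} → N a c → N b c → N (a A.∧ b) c) → Regular ⋀N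
    regular glue′ a b = antisym
      (⋀⟦⟧≤∨ (N-isFilter a) (N-isFilter b) glue′)
      (∨-least (antitone (A.x∧y≤x a b)) (antitone (A.x∧y≤y a b)))

    selfBounded : ∀ {i} (H : CoHeyting L) →
                  (∀ {a b c} → N a b → CoHeyting._∖_ H b a ≺[ i ] c → N a c) →
                  SelfBounded i ⋀N
    selfBounded H cut′ a =
      ⋀⟦ (λ x → N a (x A.∨ a)) ⟧
      , difference H a (N-isFilter a)
      -- By compactness `w ≤ ι c` means `N a (c ∨ a)`. Since `(c ∨ a) ∖ a ≤ c`, every `d` with
      -- `c ≺[ i ] d` is reached from `c ∨ a` by one cut.
      , ⋀-greatest _ _ λ { (c , w≤ιc) → ⋀⟦⟧-greatest λ c≺d →
          ⋀⟦⟧-lower (cut′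
            (⋀⟦⟧≤ι⇒∈ (difference-isFilter H a (N-isFilter a)) w≤ιc)
            (≤-≺ (x∨y∖y≤x H c a) c≺d)) }

  -- This is the `cut` case of the maximality argument. From `f a ≤ ι b ≤ ι (b ∖ a) ∨ ι a`,
  -- leastness of `w` gives `w ≤ ι (b ∖ a)`. So `b ∖ a` occurs in the meet defining `◇ᴷ[ i ] w`, and
  -- `f a ≤ ◇[ i ] (b ∖ a) ≤ ι c`.
  selfBounded⇒≤ι : ∀ {i f} (H : CoHeyting L) → SelfBounded i f →
                   ∀ {a b c} → f a ≤ ι b → CoHeyting._∖_ H b a ≺[ i ] c →
                   f a ≤ ι c
  selfBounded⇒≤ι H selfBounded {a} {b} fa≤ιb b∖a≺c with selfBounded a
  ... | w , (_ , w-least) , fa≤◇w =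
    trans fa≤◇w
      (trans (⋀-lower _ (_ ,
               w-least _ (trans fa≤ιb
                 (trans (ι-mono (x≤x∖y∨y H b a)) (ι-∨ _ a)))))
             (⋀⟦⟧-lower b∖a≺c))

  -- Maximality by induction on derivations.

  module _ {i : ℕ} {f : Map} (closedMap : IsClosedMap f) (f-antitone : Antitone f)
           (f-dominated : Dominated f) where

    -- Regularity is demanded at the one index where `glue` can occur, so a single induction serves
    -- the antitone and the regular case; at index 1 the demand is vacuous.
    D̄⇒≤ι : (i ≡ 2 → Regular f) → ∀ {a b} → a D̄[ i ] b → f a ≤ ι b
    D̄⇒≤ι regular = go
      where
      go : ∀ {a b} → a D̄[ i ] b → f a ≤ ι b
      go (base aD̄b)     = trans (f-dominated _) (⋀⟦⟧-lower aD̄b)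
      go ⊥-⊤            = closed≤ι⊤ (closed closedMap _)
      go (≤-D̄ a≤b p)    = trans (f-antitone a≤b) (go p)
      go (D̄-≤ p c≤b)    = trans (go p) (ι-mono c≤b)
      go (meet p q)     = closed≤ι∧ (closed closedMap _) (go p) (go q)
      go (glue i≡2 p q) =
        trans (reflexive (regular i≡2 _ _)) (∨-least (go p) (go q))

    D̄∖⇒≤ι : ∀ H → (i ≡ 4 → Regular f) → SelfBounded i f →
            ∀ {a b} → WithDifference._D̄∖[_]_ H a i b → f a ≤ ι b
    D̄∖⇒≤ι H regular selfBounded = go
      where
      open WithDifference H
      go : ∀ {a b} → a D̄∖[ i ] b → f a ≤ ι b
      go (base aD̄b)     = trans (f-dominated _) (⋀⟦⟧-lower aD̄b)
      go ⊥-⊤            = closed≤ι⊤ (closed closedMap _)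
      go (≤-D̄ a≤b p)    = trans (f-antitone a≤b) (go p)
      go (D̄-≤ p c≤b)    = trans (go p) (ι-mono c≤b)
      go (meet p q)     = closed≤ι∧ (closed closedMap _) (go p) (go q)
      go (glue i≡4 p q) =
        trans (reflexive (regular i≡4 _ _)) (∨-least (go p) (go q))
      go (cut _ p b∖a≺c) = selfBounded⇒≤ι H selfBounded (go p) b∖a≺c

  -- The closures as filter families, and the four extremal maps.

  D̄-isFilter : ∀ i a → IsFilter (a D̄[ i ]_)
  D̄-isFilter i a = record
    { ⊤∈       = ≤-D̄ (A.minimum a) ⊥-⊤
    ; upper    = λ b≤c p → D̄-≤ p b≤c
    ; ∧-closed = meet
    }

  D̄∖-isFilter : ∀ H i a → IsFilter (WithDifference._D̄∖[_]_ H a i)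
  D̄∖-isFilter H i a = record
    { ⊤∈       = ≤-D̄ (A.minimum a) ⊥-⊤
    ; upper    = λ b≤c p → D̄-≤ p b≤c
    ; ∧-closed = meet
    }
    where open WithDifference H

  module D̄Map (i : ℕ) = FilterMap _D̄[ i ]_ (D̄-isFilter i) ≤-D̄

  module D̄∖Map (H : CoHeyting L) (i : ℕ) where
    open WithDifference H
    open FilterMap _D̄∖[ i ]_ (D̄∖-isFilter H i) ≤-D̄ public

  ◁₁-largest : IsLargest (λ f → IsClosedMap f × Antitone f × Dominated f) ◁[ 1 ]
  ◁₁-largest =
    (isClosedMap , antitone , dominated base)
    , λ { f (closedMap , f-antitone , f-dominated) a →
          ⋀⟦⟧-greatest (D̄⇒≤ι closedMap f-antitone f-dominated λ ()) }
    where open D̄Map 1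

  ◁₂-largest : IsLargest (λ f → IsClosedMap f × Regular f × Dominated f) ◁[ 2 ]
  ◁₂-largest =
    (isClosedMap , regular (glue refl) , dominated base)
    , λ { f (closedMap , f-regular , f-dominated) a →
          ⋀⟦⟧-greatest
            (D̄⇒≤ι closedMap (regular⇒antitone closedMap f-regular) f-dominated
              λ _ → f-regular) }
    where open D̄Map 2

  module _ (H : CoHeyting L) where

    open WithDifference H

    ◁₃-largest : IsLargest
      (λ f → IsClosedMap f × Antitone f × Dominated f × SelfBounded 3 f)
      (◁∖[ 3 ] H)
    ◁₃-largest =
      ( isClosedMap , antitone , dominated base
      , selfBounded H (cut (inj₁ refl)))
      , λ { f (closedMap , f-antitone , f-dominated , f-selfBounded) a →
            ⋀⟦⟧-greatest
              (D̄∖⇒≤ι closedMap f-antitone f-dominated H (λ ()) f-selfBounded) }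
      where open D̄∖Map H 3

    ◁₄-largest : IsLargest
      (λ f → IsClosedMap f × Regular f × Dominated f × SelfBounded 4 f)
      (◁∖[ 4 ] H)
    ◁₄-largest =
      ( isClosedMap , regular (glue refl) , dominated base
      , selfBounded H (cut (inj₂ refl)))
      , λ { f (closedMap , f-regular , f-dominated , f-selfBounded) a →
            ⋀⟦⟧-greatest
              (D̄∖⇒≤ι closedMap (regular⇒antitone closedMap f-regular)
                f-dominated H (λ _ → f-regular) f-selfBounded) }
      where open D̄∖Map H 4

proposition6p4 : ∀ {ℓ c m : Level} (L : BoundedLattice ℓ ℓ ℓ) (K : ProtoSDP L) → Defined K →
    (E : CanonicalExtension (BoundedLattice.poset L) c m) →
    let open Slanted K E in
    IsLargest (λ f → IsClosedMap f × Antitone f × Dominated f) ◁[ 1 ]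
    × IsLargest (λ f → IsClosedMap f × Regular f × Dominated f) ◁[ 2 ]
    × ((H : CoHeyting L) →
    IsLargest (λ f → IsClosedMap f × Antitone f × Dominated f × SelfBounded 3 f) (◁∖[ 3 ] H)
    × IsLargest (λ f → IsClosedMap f × Regular f × Dominated f × SelfBounded 4 f) (◁∖[ 4 ] H))
proposition6p4 L K _ E = ◁₁-largest , ◁₂-largest , λ H → ◁₃-largest H , ◁₄-largest H
  where open SlantedProperties K E
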